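{- Let $G$ be a graph with $n$ vertices. If $\alpha_{ir}(G) = 1$, then (i) $\langle N_i, N_j\rangle$ is a complete bipartite graph (with partite sets $N_i$ and $N_j$) for any $i,j \in D(G)$ with $i \neq j$; (ii) the subgraph of $G$ induced by $N_k$ is $(k+n_k-n)$-regular for any $k \in D(G)$.
   Context: All graphs are finite, simple, undirected and have at least one vertex. An irregular independent set of $G$ is an independent set $A$ of $G$ such that any two distinct vertices in $A$ have different degrees in $G$; $\alpha_{ir}(G)$ is the size of a largest irregular independent set of $G$. $D(G)$ denotes the set of degrees of vertices of $G$. For $i \in D(G)$, $N_i$ denotes the set of vertices of $G$ of degree $i$, and $n_i = |N_i|$. For two disjoint subsets $X$ and $Y$ of $V(G)$, $\langle X,Y\rangle$ denotes the subgraph of $G$ with vertex set $X \cup Y$ and edge set $\{\{x,y\} \in E(G) : x \in X, y \in Y\}$. -}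

module Defs where

open import Data.Fin.Base using (Fin)
open import Data.Fin.Subset using (Subset; _∈_; _∪_; _∩_; ∣_∣; Empty; Nonempty)
open import Data.Fin.Subset.Properties using (_∈?_; x∈p∪q⁺)
open import Data.Integer.Base using (ℤ; +_)
open import Data.Nat.Base using (ℕ; NonZero; _≤_)
open import Data.Nat.Properties using (_≟_)
open import Data.Product.Base using (∃; _×_; _,_; proj₁; proj₂)
open import Data.Sum.Base using (_⊎_; inj₁; inj₂)
open import Data.Vec.Base using (tabulate)
open import Function.Base using (_∘_)
open import Function.Bundles using (_⇔_)
open import Level using (0ℓ)
open import Relation.Binary.Core using (Rel)
open import Relation.Binary.Definitions using (Irreflexive; Symmetric)
  renaming (Decidable to Decidable₂)
open import Relation.Binary.PropositionalEquality using (_≡_; _≢_)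
open import Relation.Nullary using (¬_; does; _×-dec_; _⊎-dec_)
open import Relation.Unary using (Pred; Decidable)

-- A finite simple graph with vertex set Fin n.
record Graph (n : ℕ) : Set₁ where
  infix 4 _~_ _~?_
  field
    {{nonZero}} : NonZero n
    _~_         : Rel (Fin n) 0ℓ
    _~?_        : Decidable₂ _~_
    ~-sym       : Symmetric _~_
    ~-irrefl    : Irreflexive _≡_ _~_

toSubset : ∀ {n} {P : Pred (Fin n) 0ℓ} → Decidable P → Subset n
toSubset P? = tabulate (does ∘ P?)

module _ {n : ℕ} (G : Graph n) where
  open Graph G

  degree : Fin n → ℕ
  degree u = ∣ toSubset (λ v → u ~? v) ∣

  Independent : Pred (Subset n) 0ℓ
  Independent A = ∀ {u v} → u ∈ A → v ∈ A → ¬ (u ~ v)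

  IrregularIndependent : Pred (Subset n) 0ℓ
  IrregularIndependent A =
    Independent A × (∀ {u v} → u ∈ A → v ∈ A → u ≢ v → degree u ≢ degree v)

  LargestIrregularIndependent : Pred (Subset n) 0ℓ
  LargestIrregularIndependent A =
    IrregularIndependent A × (∀ B → IrregularIndependent B → ∣ B ∣ ≤ ∣ A ∣)

  -- HasαIr G is the graph of the function α_ir: it holds of a unique k,
  -- because any two largest irregular independent sets have the same size.
  HasαIr : Pred ℕ 0ℓ
  HasαIr k = ∃ λ A → LargestIrregularIndependent A × ∣ A ∣ ≡ k

  -- D(G), as a predicate on ℕ.
  D : Pred ℕ 0ℓ
  D i = ∃ λ v → degree v ≡ i

  N : ℕ → Subset n
  N i = toSubset (λ v → degree v ≟ i)

  record Subgraph : Set₁ where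
    infix 4 _~ˢ_ _~ˢ?_
    field
      V          : Subset n
      _~ˢ_       : Rel (Fin n) 0ℓ
      _~ˢ?_      : Decidable₂ _~ˢ_
      ~ˢ-sym     : Symmetric _~ˢ_
      ~ˢ⇒~       : ∀ {u v} → u ~ˢ v → u ~ v
      endpoints  : ∀ {u v} → u ~ˢ v → u ∈ V × v ∈ V

  -- Unordered edges {x , y} with x ∈ X and y ∈ Y: either endpoint may be listed
  -- first.
  Between : Subset n → Subset n → Rel (Fin n) 0ℓ
  Between X Y u v = (u ∈ X × v ∈ Y) ⊎ (u ∈ Y × v ∈ X)

  ⟨_,_⟩ : Subset n → Subset n → Subgraph
  ⟨ X , Y ⟩ = record
    { V          = X ∪ Y
    ; _~ˢ_       = λ u v → u ~ v × Between X Y u v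
    ; _~ˢ?_      = λ u v → (u ~? v) ×-dec
                    (((u ∈? X) ×-dec (v ∈? Y)) ⊎-dec ((u ∈? Y) ×-dec (v ∈? X)))
    ; ~ˢ-sym     = λ where
        (e , inj₁ (p , q)) → ~-sym e , inj₂ (q , p)
        (e , inj₂ (p , q)) → ~-sym e , inj₁ (q , p)
    ; ~ˢ⇒~       = proj₁
    ; endpoints  = λ where
        (_ , inj₁ (p , q)) → x∈p∪q⁺ (inj₁ p) , x∈p∪q⁺ (inj₂ q)
        (_ , inj₂ (p , q)) → x∈p∪q⁺ (inj₂ p) , x∈p∪q⁺ (inj₁ q)
    }

  induced : Subset n → Subgraph
  induced X = record
    { V          = X
    ; _~ˢ_       = λ u v → u ~ v × u ∈ X × v ∈ X
    ; _~ˢ?_      = λ u v → (u ~? v) ×-dec ((u ∈? X) ×-dec (v ∈? X))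
    ; ~ˢ-sym     = λ (e , p , q) → ~-sym e , q , p
    ; ~ˢ⇒~       = proj₁
    ; endpoints  = proj₂
    }

  module _ (H : Subgraph) where
    open Subgraph H

    record CompleteBipartite (X Y : Subset n) : Set where
      field
        vertices  : V ≡ X ∪ Y
        disjoint  : Empty (X ∩ Y)
        nonemptyˡ : Nonempty X
        nonemptyʳ : Nonempty Y
        edges     : ∀ {u v} → u ~ˢ v ⇔ Between X Y u v

    subdegree : Fin n → ℕ
    subdegree u = ∣ toSubset (λ v → u ~ˢ? v) ∣

    -- The parameter is an integer so that expressions such as k + n_k - n are
    -- not truncated at 0.
    Regular : Pred ℤ 0ℓ
    Regular r = ∀ {v} → v ∈ V → + subdegree v ≡ r

{-# OPTIONS --safe #-}
-- Two nonadjacent vertices of different degrees would form an irregular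
-- independent set of size 2, so vertices of different degrees are adjacent; this
-- is (i).  Hence the neighbourhood of a vertex of degree k and N_k together cover
-- all vertices, and (ii) follows by counting their union and intersection.
module Submission where

open import Defs
open import Data.Bool.Base using (true; false)
open import Data.Fin.Base using (Fin)
open import Data.Fin.Subset using (Subset; _∈_; _∪_; _∩_; ∣_∣; ⁅_⁆; ⊤)
open import Data.Fin.Subset.Properties
  using (x∈p∪q⁺; x∈p∪q⁻; x∈p∩q⁺; x∈p∩q⁻; x∈⁅x⁆; x∈⁅y⁆⇒x≡y; ∣⁅x⁆∣≡1; ∣⊤∣≡n; ⊆-antisym; ∈⊤; p⊆p∪q; p⊂q⇒∣p∣<∣q∣)
open import Data.Integer.Base using (+_; _+_; _-_; -_)
import Data.Integer.Properties as ℤ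
open import Data.Nat.Base as ℕ using (ℕ; _≤_)
import Data.Nat.Properties as ℕ
open import Data.Product.Base using (_×_; _,_; uncurry)
open import Data.Sum.Base using (inj₁; inj₂)
open import Data.Vec.Base using ([]; _∷_)
open import Data.Vec.Properties using (lookup⇒[]=; []=⇒lookup; lookup∘tabulate)
open import Function.Base using (_∘_)
open import Function.Bundles using (mk⇔)
open import Level using (0ℓ)
open import Relation.Binary.PropositionalEquality
  using (_≡_; _≢_; refl; sym; trans; cong; cong₂; subst; module ≡-Reasoning)
open import Relation.Nullary using (¬_; yes; no; does; contradiction)
open import Relation.Nullary.Decidable using (dec-true; decidable-stable)
open import Relation.Unary using (Pred; Decidable)

-- Inclusion-exclusion in additive form, by induction on positions: a position contributes to both
-- sides the number of the two sets that contain it.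
∣p∪q∣+∣p∩q∣≡∣p∣+∣q∣ : ∀ {n} (p q : Subset n) →
  ∣ p ∪ q ∣ ℕ.+ ∣ p ∩ q ∣ ≡ ∣ p ∣ ℕ.+ ∣ q ∣
∣p∪q∣+∣p∩q∣≡∣p∣+∣q∣ []          []          = refl
∣p∪q∣+∣p∩q∣≡∣p∣+∣q∣ (false ∷ p) (false ∷ q) = ∣p∪q∣+∣p∩q∣≡∣p∣+∣q∣ p q
∣p∪q∣+∣p∩q∣≡∣p∣+∣q∣ (false ∷ p) (true  ∷ q) =
  trans (cong ℕ.suc (∣p∪q∣+∣p∩q∣≡∣p∣+∣q∣ p q)) (sym (ℕ.+-suc ∣ p ∣ ∣ q ∣))
∣p∪q∣+∣p∩q∣≡∣p∣+∣q∣ (true  ∷ p) (false ∷ q) =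
  cong ℕ.suc (∣p∪q∣+∣p∩q∣≡∣p∣+∣q∣ p q)
∣p∪q∣+∣p∩q∣≡∣p∣+∣q∣ (true  ∷ p) (true  ∷ q) = cong ℕ.suc (begin
  ∣ p ∪ q ∣ ℕ.+ ℕ.suc ∣ p ∩ q ∣   ≡⟨ ℕ.+-suc ∣ p ∪ q ∣ ∣ p ∩ q ∣ ⟩
  ℕ.suc (∣ p ∪ q ∣ ℕ.+ ∣ p ∩ q ∣) ≡⟨ cong ℕ.suc (∣p∪q∣+∣p∩q∣≡∣p∣+∣q∣ p q) ⟩
  ℕ.suc (∣ p ∣ ℕ.+ ∣ q ∣)         ≡⟨ ℕ.+-suc ∣ p ∣ ∣ q ∣ ⟨
  ∣ p ∣ ℕ.+ ℕ.suc ∣ q ∣           ∎)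
  where open ≡-Reasoning

-- The singleton of `x` has size 1 and is a proper subset, since it misses `y`.
x≢y⇒1<∣⁅x⁆∪⁅y⁆∣ : ∀ {n} {x y : Fin n} → x ≢ y → 1 ℕ.< ∣ ⁅ x ⁆ ∪ ⁅ y ⁆ ∣
x≢y⇒1<∣⁅x⁆∪⁅y⁆∣ {x = x} {y} x≢y =
  subst (ℕ._< ∣ ⁅ x ⁆ ∪ ⁅ y ⁆ ∣) (∣⁅x⁆∣≡1 x)
    (p⊂q⇒∣p∣<∣q∣ (p⊆p∪q ⁅ y ⁆ , y , x∈p∪q⁺ (inj₂ (x∈⁅x⁆ y)) , x≢y ∘ sym ∘ x∈⁅y⁆⇒x≡y x))

module _ {n} {P : Pred (Fin n) 0ℓ} (P? : Decidable P) where

  ∈-toSubset⁺ : ∀ {x} → P x → x ∈ toSubset P?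
  ∈-toSubset⁺ {x} px =
    lookup⇒[]= x _ (trans (lookup∘tabulate (does ∘ P?) x) (dec-true (P? x) px))

  ∈-toSubset⁻ : ∀ {x} → x ∈ toSubset P? → P x
  -- In the `no` case the second equation becomes `false ≡ true`, so only the `yes` clause remains.
  ∈-toSubset⁻ {x} x∈ with P? x | trans (sym (lookup∘tabulate (does ∘ P?) x)) ([]=⇒lookup x∈)
  ... | yes px | _ = px

module _ {n} (G : Graph n) where
  open Graph G

  ∈-N⁺ : ∀ {i v} → degree G v ≡ i → v ∈ N G i
  ∈-N⁺ {i} = ∈-toSubset⁺ (λ v → degree G v ℕ.≟ i)

  ∈-N⁻ : ∀ {i v} → v ∈ N G i → degree G v ≡ i
  ∈-N⁻ {i} = ∈-toSubset⁻ (λ v → degree G v ℕ.≟ i)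

  -- Both conditions reduce to the mixed choice of one `u` and one `v`: a repeated vertex is
  -- excluded by irreflexivity in the first condition and by `x ≢ y` in the second.
  pair-irregularIndependent : ∀ {u v} → degree G u ≢ degree G v → ¬ (u ~ v) →
    IrregularIndependent G (⁅ u ⁆ ∪ ⁅ v ⁆)
  pair-irregularIndependent {u} {v} du≢dv u≁v = independent , irregular
    where
    independent : Independent G (⁅ u ⁆ ∪ ⁅ v ⁆)
    independent x∈ y∈ x~y with x∈p∪q⁻ ⁅ u ⁆ ⁅ v ⁆ x∈ | x∈p∪q⁻ ⁅ u ⁆ ⁅ v ⁆ y∈
    ... | inj₁ p | inj₁ q = ~-irrefl (trans (x∈⁅y⁆⇒x≡y u p) (sym (x∈⁅y⁆⇒x≡y u q))) x~y
    ... | inj₂ p | inj₂ q = ~-irrefl (trans (x∈⁅y⁆⇒x≡y v p) (sym (x∈⁅y⁆⇒x≡y v q))) x~y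
    ... | inj₁ p | inj₂ q with refl ← x∈⁅y⁆⇒x≡y u p | refl ← x∈⁅y⁆⇒x≡y v q = u≁v x~y
    ... | inj₂ p | inj₁ q with refl ← x∈⁅y⁆⇒x≡y v p | refl ← x∈⁅y⁆⇒x≡y u q = u≁v (~-sym x~y)

    irregular : ∀ {x y} → x ∈ ⁅ u ⁆ ∪ ⁅ v ⁆ → y ∈ ⁅ u ⁆ ∪ ⁅ v ⁆ → x ≢ y →
      degree G x ≢ degree G y
    irregular x∈ y∈ x≢y with x∈p∪q⁻ ⁅ u ⁆ ⁅ v ⁆ x∈ | x∈p∪q⁻ ⁅ u ⁆ ⁅ v ⁆ y∈
    ... | inj₁ p | inj₁ q = contradiction (trans (x∈⁅y⁆⇒x≡y u p) (sym (x∈⁅y⁆⇒x≡y u q))) x≢y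
    ... | inj₂ p | inj₂ q = contradiction (trans (x∈⁅y⁆⇒x≡y v p) (sym (x∈⁅y⁆⇒x≡y v q))) x≢y
    ... | inj₁ p | inj₂ q with refl ← x∈⁅y⁆⇒x≡y u p | refl ← x∈⁅y⁆⇒x≡y v q = du≢dv
    ... | inj₂ p | inj₁ q with refl ← x∈⁅y⁆⇒x≡y v p | refl ← x∈⁅y⁆⇒x≡y u q = du≢dv ∘ sym

  module _ (αir≡1 : HasαIr G 1) where

    degree≢⇒~ : ∀ {u v} → degree G u ≢ degree G v → u ~ v
    degree≢⇒~ {u} {v} du≢dv =
      let _ , (_ , largest) , ∣A∣≡1 = αir≡1 in
      -- Maximality only refutes nonadjacency; decidability of `_~_` turns this into an edge.
      decidable-stable (u ~? v) λ u≁v →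
        ℕ.<⇒≱ (x≢y⇒1<∣⁅x⁆∪⁅y⁆∣ (du≢dv ∘ cong (degree G)))
          (subst (∣ ⁅ u ⁆ ∪ ⁅ v ⁆ ∣ ≤_) ∣A∣≡1
            (largest _ (pair-irregularIndependent du≢dv u≁v)))

    -- Membership of `i` and `j` in D(G) makes the two parts nonempty, and `i ≢ j` gives both their
    -- disjointness and all the edges across.
    completeBipartite : ∀ {i j} → D G i → D G j → i ≢ j →
      CompleteBipartite G (⟨_,_⟩ G (N G i) (N G j)) (N G i) (N G j)
    completeBipartite {i} {j} (u , du≡i) (v , dv≡j) i≢j = record
      { vertices  = refl
      ; disjoint  = λ (_ , x∈) → i≢j (uncurry same-degree (x∈p∩q⁻ _ _ x∈))
      ; nonemptyˡ = u , ∈-N⁺ du≡i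
      ; nonemptyʳ = v , ∈-N⁺ dv≡j
      ; edges     = mk⇔ (λ (_ , b) → b) λ where
          b@(inj₁ (x∈ , y∈)) → adjacent x∈ y∈ , b
          b@(inj₂ (x∈ , y∈)) → ~-sym (adjacent y∈ x∈) , b
      }
      where
      same-degree : ∀ {x} → x ∈ N G i → x ∈ N G j → i ≡ j
      same-degree p q = trans (sym (∈-N⁻ p)) (∈-N⁻ q)

      adjacent : ∀ {x y} → x ∈ N G i → y ∈ N G j → x ~ y
      adjacent x∈ y∈ = degree≢⇒~ λ dx≡dy →
        i≢j (trans (sym (∈-N⁻ x∈)) (trans dx≡dy (∈-N⁻ y∈)))

    -- Inclusion-exclusion for the neighbourhood `A` of `v` and `N G k`: the union is the whole
    -- vertex set, and the intersection is the neighbourhood of `v` in the induced subgraph. The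
    -- additive form avoids truncated subtraction.
    n+subdegree≡k+∣N∣ : ∀ {k v} → v ∈ N G k →
      n ℕ.+ subdegree G (induced G (N G k)) v ≡ k ℕ.+ ∣ N G k ∣
    n+subdegree≡k+∣N∣ {k} {v} v∈ = begin
      n ℕ.+ subdegree G (induced G (N G k)) v ≡⟨ cong₂ ℕ._+_ (∣⊤∣≡n n) (cong ∣_∣ meet) ⟨
      ∣ ⊤ {n} ∣ ℕ.+ ∣ A ∩ N G k ∣             ≡⟨ cong (λ p → ∣ p ∣ ℕ.+ ∣ A ∩ N G k ∣) cover ⟨
      ∣ A ∪ N G k ∣ ℕ.+ ∣ A ∩ N G k ∣         ≡⟨ ∣p∪q∣+∣p∩q∣≡∣p∣+∣q∣ A (N G k) ⟩
      degree G v ℕ.+ ∣ N G k ∣                ≡⟨ cong (ℕ._+ ∣ N G k ∣) (∈-N⁻ v∈) ⟩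
      k ℕ.+ ∣ N G k ∣                         ∎
      where
      open ≡-Reasoning
      open Subgraph (induced G (N G k)) using (_~ˢ?_)

      A : Subset n
      A = toSubset (v ~?_)

      meet : A ∩ N G k ≡ toSubset (v ~ˢ?_)
      meet = ⊆-antisym
        -- An edge of the induced subgraph records that both endpoints lie in `N G k`; for `v` this
        -- is `v∈`.
        (λ x∈ → let x∈A , x∈N = x∈p∩q⁻ A (N G k) x∈ in
          ∈-toSubset⁺ (v ~ˢ?_) (∈-toSubset⁻ (v ~?_) x∈A , v∈ , x∈N))
        (λ x∈ → let v~x , _ , x∈N = ∈-toSubset⁻ (v ~ˢ?_) x∈ in
          x∈p∩q⁺ (∈-toSubset⁺ (v ~?_) v~x , x∈N))

      -- A vertex outside `N G k` differs from `v` in degree, hence is a neighbour of `v`.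
      covered : ∀ x → x ∈ A ∪ N G k
      covered x with degree G x ℕ.≟ k
      ... | yes dx≡k = x∈p∪q⁺ (inj₂ (∈-N⁺ dx≡k))
      ... | no  dx≢k = x∈p∪q⁺ (inj₁ (∈-toSubset⁺ (v ~?_)
        (degree≢⇒~ λ dv≡dx → dx≢k (trans (sym dv≡dx) (∈-N⁻ v∈)))))

      cover : A ∪ N G k ≡ ⊤
      cover = ⊆-antisym (λ _ → ∈⊤) (λ {x} _ → covered x)

    regular : ∀ k → Regular G (induced G (N G k)) ((+ k + + ∣ N G k ∣) - + n)
    regular k {v} v∈ = begin
      -- Adding and cancelling `n` in ℤ brings in the sum that the counting identity rewrites;
      -- `+ a + + b` computes to `+ (a ℕ.+ b)`, so the casts need no steps of their own.
      + s                         ≡⟨ ℤ.+-identityʳ (+ s) ⟨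
      + s + + 0                   ≡⟨ cong (λ z → + s + z) (ℤ.+-inverseʳ (+ n)) ⟨
      + s + (+ n - + n)           ≡⟨ ℤ.+-assoc (+ s) (+ n) (- + n) ⟨
      + (s ℕ.+ n) - + n           ≡⟨ cong (λ m → + m - + n) (ℕ.+-comm s n) ⟩
      + (n ℕ.+ s) - + n           ≡⟨ cong (λ m → + m - + n) (n+subdegree≡k+∣N∣ v∈) ⟩
      (+ k + + ∣ N G k ∣) - + n   ∎
      where
      open ≡-Reasoning

      s : ℕ
      s = subdegree G (induced G (N G k)) v

lemma3p1 : ∀ {n : ℕ} (G : Graph n) → HasαIr G 1 →
    (∀ (i j : ℕ) → D G i → D G j → i ≢ j → CompleteBipartite G (⟨_,_⟩ G (N G i) (N G j)) (N G i) (N G j))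
    × (∀ (k : ℕ) → D G k → Regular G (induced G (N G k)) ((+ k + + ∣ N G k ∣) - + n))
lemma3p1 G αir≡1 =
  (λ _ _ → completeBipartite G αir≡1) , (λ k _ → regular G αir≡1 k)
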